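{- Let $n$ be a positive integer. For every $i$ with $0\le i\le n-1$, the number of signed permutations in $\mathfrak{B}_n$ with exactly $i+1$ augmented descents is $2^n$ times the number of permutations in $\mathfrak{S}_n$ with exactly $i$ descents. In other words, $$A_n^{(a)}(t)=2^n A_n(t),$$ where $A_n^{(a)}(t)=\sum_{\pi\in\mathfrak{B}_n}t^{\operatorname{ades}(\pi)}$ and $A_n(t)=\sum_{\pi\in\mathfrak{S}_n}t^{\operatorname{des}(\pi)+1}$.
   Context: $\mathfrak{S}_n$ is the symmetric group of bijections of $\{1,\ldots,n\}$. For $\pi\in\mathfrak{S}_n$, the number of descents $\operatorname{des}(\pi)$ is the number of $i\in\{1,\ldots,n-1\}$ with $\pi(i)>\pi(i+1)$. $\mathfrak{B}_n$ is the hyperoctahedral group: the group of all bijections $\pi$ of $\{ -n,\ldots,-1,0,1,\ldots,n\}$ with $\pi(-s)=-\pi(s)$ for $s=0,1,\ldots,n$ (so $\pi(0)=0$); its elements are called signed permutations. A signed permutation $\pi\in\mathfrak{B}_n$ has an augmented descent at position $i\in\{0,1,\ldots,n\}$ if $0\le i\le n-1$ and $\pi(i)>\pi(i+1)$, or if $i=n$ and $\pi(n)>0$. The augmented descent number $\operatorname{ades}(\pi)$ is the number of augmented descents of $\pi$. -}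

module Defs where

open import Data.Bool.Base using (if_then_else_)
open import Data.Fin.Base using (Fin; zero; suc; toℕ; fromℕ; fromℕ<; inject₁)
import Data.Fin.Base as Fin
open import Data.Fin.Permutation as Perm
  using (Permutation′; _⟨$⟩ʳ_; insert; remove; insert-remove; remove-insert; insert-punchIn)
import Data.Fin.Properties as Fin
open import Data.Integer.Base using (ℤ; +_; -[1+_]; 0ℤ; -_; ∣_∣)
import Data.Integer.Base as ℤ
import Data.Integer.Properties as ℤ
open import Data.List.Base
  using (List; []; _∷_; _++_; [_]; length; filter; map; foldr; replicate; allFin; cartesianProductWith)
import Data.List.Membership.Propositional.Properties as Membership
import Data.List.Membership.Setoid as SetoidMem
import Data.List.Membership.Setoid.Properties as SetoidMembership
open import Data.List.Relation.Unary.All using (All; []; _∷_)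
open import Data.List.Relation.Unary.AllPairs using ([]; _∷_)
open import Data.List.Relation.Unary.Any using (here; there)
open import Data.List.Relation.Unary.Enumerates.Setoid using (IsEnumeration)
open import Data.List.Relation.Unary.Enumerates.Setoid.Properties using () renaming (map⁺ to enum-map⁺)
import Data.List.Relation.Unary.Unique.Propositional.Properties as Unique
open import Data.List.Relation.Unary.Unique.Setoid using (Unique)
import Data.List.Relation.Unary.Unique.Setoid.Properties as SetoidUnique
open import Data.Nat.Base using (ℕ; zero; suc; _+_; _*_; _≤_; s≤s)
import Data.Nat.Properties as ℕ
open import Data.Product.Base using (Σ; Σ-syntax; _×_; _,_; proj₁; proj₂)
open import Data.Sum.Base using (_⊎_; inj₁; inj₂)
open import Function.Base using (_∘_)
open import Function.Bundles using (_↔_; Inverse; mk↔ₛ′; Surjection)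
open import Function.Construct.Composition using (_↔-∘_)
open import Function.Construct.Symmetry using (↔-sym)
open import Level using (0ℓ)
open import Relation.Binary.Bundles using (Setoid)
import Relation.Binary.Construct.On as On
open import Relation.Binary.PropositionalEquality
  using (_≡_; refl; sym; trans; cong; subst; setoid; module ≡-Reasoning)
open import Relation.Nullary using (does; yes; no; contradiction)
open import Relation.Nullary.Decidable using (map′)
open import Relation.Unary using (Pred; Decidable)

-- A bijection is a record that also stores proofs, so bijections are compared
-- by their values; a finite set is a setoid with a duplicate-free enumeration.
record Finite (S : Setoid 0ℓ 0ℓ) : Set where
  field
    elements : List (Setoid.Carrier S)
    complete : IsEnumeration S elements
    unique   : Unique S elements

  number : {P : Pred (Setoid.Carrier S) 0ℓ} → Decidable P → ℕ
  number P? = length (filter P? elements)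

open Finite public

Bijections : Set → Set → Setoid 0ℓ 0ℓ
Bijections A B = record
  { Carrier       = A ↔ B
  ; _≈_           = λ π ρ → ∀ x → Inverse.to π x ≡ Inverse.to ρ x
  ; isEquivalence = record
    { refl  = λ _ → refl
    ; sym   = λ e x → sym (e x)
    ; trans = λ e f x → trans (e x) (f x)
    }
  }

Subset : (S : Setoid 0ℓ 0ℓ) → Pred (Setoid.Carrier S) 0ℓ → Setoid 0ℓ 0ℓ
Subset S P = On.setoid S (proj₁ {B = P})

-- The letters 1, …, n are the elements 0, …, n - 1 of Fin n.
𝔖 : ℕ → Setoid 0ℓ 0ℓ
𝔖 n = Bijections (Fin n) (Fin n)

des : ∀ {n} → Permutation′ n → ℕ
des {zero}  π = 0
des {suc m} π = length (filter (λ i → π ⟨$⟩ʳ suc i Fin.<? π ⟨$⟩ʳ inject₁ i) (allFin m))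

-- The set {-n, …, -1, 0, 1, …, n}.
± : ℕ → Set
± n = Σ[ z ∈ ℤ ] ∣ z ∣ ≤ n

neg : ∀ {n} → ± n → ± n
neg {n} (z , p) = - z , subst (_≤ n) (sym (ℤ.∣-i∣≡∣i∣ z)) p

pos : ∀ {n} → Fin (suc n) → ± n
pos i = + toℕ i , Fin.toℕ≤pred[n] i

IsSigned : ∀ {n} → ± n ↔ ± n → Set
IsSigned {n} π = ∀ (s : Fin (suc n)) → Inverse.to π (neg (pos s)) ≡ neg (Inverse.to π (pos s))

𝔅 : ℕ → Setoid 0ℓ 0ℓ
𝔅 n = Subset (Bijections (± n) (± n)) IsSigned

SignedPermutation : ℕ → Set
SignedPermutation n = Setoid.Carrier (𝔅 n)

-- The integer π(s), for 0 ≤ s ≤ n.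
_⟨_⟩ : ∀ {n} → SignedPermutation n → Fin (suc n) → ℤ
(π , _) ⟨ s ⟩ = proj₁ (Inverse.to π (pos s))

-- Positions 0 ≤ i ≤ n - 1 are compared with their successor, position n with 0.
ades : ∀ {n} → SignedPermutation n → ℕ
ades {n} π =
  length (filter (λ i → π ⟨ suc i ⟩ ℤ.<? π ⟨ inject₁ i ⟩) (allFin n))
  + (if does (0ℤ ℤ.<? π ⟨ fromℕ n ⟩) then 1 else 0)

𝔖-finite : ∀ n → Finite (𝔖 n)
𝔖-finite zero = record
  { elements = [ Perm.id ]
  ; complete = λ _ → here λ ()
  ; unique   = [] ∷ []
  }
𝔖-finite (suc n) = record
  { elements = cartesianProductWith (insert zero) (allFin (suc n)) (elements (𝔖-finite n))
  ; complete = λ π → SetoidMembership.∈-resp-≈ (𝔖 (suc n))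
      {x = insert zero (π ⟨$⟩ʳ zero) (remove zero π)} {y = π} (insert-remove zero π)
      (SetoidMembership.∈-cartesianProductWith⁺ (setoid _) (𝔖 n) (𝔖 (suc n))
        (λ {i} {j} {π} {ρ} → insert-cong {i} {j} {π} {ρ})
        (Membership.∈-allFin (π ⟨$⟩ʳ zero)) (complete (𝔖-finite n) (remove zero π)))
  ; unique   = SetoidUnique.cartesianProductWith⁺ (setoid _) (𝔖 n) (𝔖 (suc n))
      (insert zero) (λ {i} {j} {π} {ρ} → insert-injective {i} {j} {π} {ρ})
      (Unique.allFin⁺ (suc n)) (unique (𝔖-finite n))
  }
  where
  insert-cong : ∀ {i j : Fin (suc n)} {π ρ : Permutation′ n} →
                i ≡ j → π Perm.≈ ρ → insert zero i π Perm.≈ insert zero j ρ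
  insert-cong refl e zero    = refl
  insert-cong {i} {_} {π} {ρ} refl e (suc k) = begin
    insert zero i π ⟨$⟩ʳ suc k       ≡⟨ insert-punchIn zero i π k ⟩
    Fin.punchIn i (π ⟨$⟩ʳ k)         ≡⟨ cong (Fin.punchIn i) (e k) ⟩
    Fin.punchIn i (ρ ⟨$⟩ʳ k)         ≡⟨ insert-punchIn zero i ρ k ⟨
    insert zero i ρ ⟨$⟩ʳ suc k       ∎
    where open ≡-Reasoning

  insert-injective : ∀ {i j : Fin (suc n)} {π ρ : Permutation′ n} →
                     insert zero i π Perm.≈ insert zero j ρ → i ≡ j × π Perm.≈ ρ
  insert-injective {i} {j} {π} {ρ} e with refl ← e zero =
    refl , λ k → Fin.punchIn-injective i _ _ (begin
      Fin.punchIn i (π ⟨$⟩ʳ k)       ≡⟨ insert-punchIn zero i π k ⟨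
      insert zero i π ⟨$⟩ʳ suc k     ≡⟨ e (suc k) ⟩
      insert zero i ρ ⟨$⟩ʳ suc k     ≡⟨ insert-punchIn zero i ρ k ⟩
      Fin.punchIn i (ρ ⟨$⟩ʳ k)       ∎)
    where open ≡-Reasoning

±-≡ : ∀ {n} {x y : ± n} → proj₁ x ≡ proj₁ y → x ≡ y
±-≡ {x = z , p} {y = _ , q} refl = cong (z ,_) (ℕ.≤-irrelevant p q)

±↔Fin : ∀ n → ± n ↔ Fin (n + suc n)
±↔Fin n = ↔-sym (Fin.+↔⊎ {n} {suc n}) ↔-∘ mk↔ₛ′ to from to-from from-to
  where
  to : ± n → Fin n ⊎ Fin (suc n)
  to (-[1+ k ] , p) = inj₁ (fromℕ< p)
  to (+ k      , p) = inj₂ (fromℕ< (s≤s p))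

  from : Fin n ⊎ Fin (suc n) → ± n
  from (inj₁ i) = -[1+ toℕ i ] , Fin.toℕ<n i
  from (inj₂ i) = pos i

  to-from : ∀ x → to (from x) ≡ x
  to-from (inj₁ i) = cong inj₁ (Fin.fromℕ<-toℕ i _)
  to-from (inj₂ i) = cong inj₂ (Fin.fromℕ<-toℕ i _)

  from-to : ∀ x → from (to x) ≡ x
  from-to (-[1+ k ] , p) = ±-≡ (cong -[1+_] (Fin.toℕ-fromℕ< p))
  from-to (+ k      , p) = ±-≡ (cong +_ (Fin.toℕ-fromℕ< (s≤s p)))

Bijections-finite : ∀ {A n} → A ↔ Fin n → Finite (Bijections A A)
Bijections-finite {A} {n} e = record
  { elements = map conj (elements (𝔖-finite n))
  ; complete = enum-map⁺ (𝔖 n) (Bijections A A) conj-surjection (complete (𝔖-finite n))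
  ; unique   = SetoidUnique.map⁺ (𝔖 n) (Bijections A A)
                 (λ {π} {ρ} → conj-injective {π} {ρ}) (unique (𝔖-finite n))
  }
  where
  open Inverse e using (to; from; strictlyInverseˡ; strictlyInverseʳ)

  conj : Permutation′ n → A ↔ A
  conj π = ↔-sym e ↔-∘ (π ↔-∘ e)

  conj-surjection : Surjection (𝔖 n) (Bijections A A)
  conj-surjection = record
    { to         = conj
    ; cong       = λ h x → cong from (h (to x))
    ; surjective = λ π → e ↔-∘ (π ↔-∘ ↔-sym e) , λ {ρ} h x → begin
        from (ρ ⟨$⟩ʳ to x)                              ≡⟨ cong from (h (to x)) ⟩
        from (to (Inverse.to π (from (to x))))          ≡⟨ strictlyInverseʳ _ ⟩
        Inverse.to π (from (to x))                      ≡⟨ cong (Inverse.to π) (strictlyInverseʳ x) ⟩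
        Inverse.to π x                                  ∎
    }
    where open ≡-Reasoning

  conj-injective : ∀ {π ρ : Permutation′ n} →
                   (∀ x → Inverse.to (conj π) x ≡ Inverse.to (conj ρ) x) → π Perm.≈ ρ
  conj-injective {π} {ρ} h i = begin
    π ⟨$⟩ʳ i                        ≡⟨ cong (π ⟨$⟩ʳ_) (strictlyInverseˡ i) ⟨
    π ⟨$⟩ʳ to (from i)              ≡⟨ strictlyInverseˡ _ ⟨
    to (from (π ⟨$⟩ʳ to (from i)))  ≡⟨ cong to (h (from i)) ⟩
    to (from (ρ ⟨$⟩ʳ to (from i)))  ≡⟨ strictlyInverseˡ _ ⟩
    ρ ⟨$⟩ʳ to (from i)              ≡⟨ cong (ρ ⟨$⟩ʳ_) (strictlyInverseˡ i) ⟩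
    ρ ⟨$⟩ʳ i                        ∎
    where open ≡-Reasoning

module _ {S : Setoid 0ℓ 0ℓ} {P : Pred (Setoid.Carrier S) 0ℓ}
         (P? : Decidable P) (P-resp : ∀ {x y} → Setoid._≈_ S x y → P x → P y) where

  open Setoid S using (Carrier; _≈_)
  open SetoidMem S using (_∈_)
  open SetoidMem (Subset S P) using () renaming (_∈_ to _∈ₚ_)

  restrict : List Carrier → List (Σ Carrier P)
  restrict []       = []
  restrict (x ∷ xs) with P? x
  ... | yes px = (x , px) ∷ restrict xs
  ... | no  _  = restrict xs

  ∈-restrict⁺ : ∀ {x xs} (px : P x) → x ∈ xs → (x , px) ∈ₚ restrict xs
  ∈-restrict⁺ {xs = y ∷ ys} px x∈ with P? y | x∈
  ... | yes _  | here x≈y  = here x≈y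
  ... | yes _  | there x∈′ = there (∈-restrict⁺ px x∈′)
  ... | no ¬py | here x≈y  = contradiction (P-resp x≈y px) ¬py
  ... | no _   | there x∈′ = ∈-restrict⁺ px x∈′

  restrict-All : ∀ {ℓ} {Q : Pred Carrier ℓ} {xs} → All Q xs → All (Q ∘ proj₁) (restrict xs)
  restrict-All [] = []
  restrict-All {xs = x ∷ xs} (q ∷ qs) with P? x
  ... | yes _ = q ∷ restrict-All qs
  ... | no  _ = restrict-All qs

  restrict-Unique : ∀ {xs} → Unique S xs → Unique (Subset S P) (restrict xs)
  restrict-Unique [] = []
  restrict-Unique {x ∷ xs} (x∉ ∷ xs!) with P? x
  ... | yes _ = restrict-All x∉ ∷ restrict-Unique xs!
  ... | no  _ = restrict-Unique xs!

  Subset-finite : Finite S → Finite (Subset S P)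
  Subset-finite F = record
    { elements = restrict (elements F)
    ; complete = λ (x , px) → ∈-restrict⁺ px (complete F x)
    ; unique   = restrict-Unique (unique F)
    }

𝔅-finite : ∀ n → Finite (𝔅 n)
𝔅-finite n = Subset-finite
  (λ π → Fin.all? λ s → map′ ±-≡ (cong proj₁) (_ ℤ.≟ _))
  (λ h o s → trans (sym (h _)) (trans (o s) (cong neg (h _))))
  (Bijections-finite (±↔Fin n))

-- Polynomials over ℕ in t, as lists of coefficients in increasing degree;
-- trailing zeros are allowed, so equality is coefficientwise.

ℕ[t] : Set
ℕ[t] = List ℕ

coeff : ℕ[t] → ℕ → ℕ
coeff []      _       = 0
coeff (a ∷ p) zero    = a
coeff (a ∷ p) (suc k) = coeff p k

infix 4 _≋_
_≋_ : ℕ[t] → ℕ[t] → Set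
p ≋ q = ∀ k → coeff p k ≡ coeff q k

infixl 6 _⊕_
_⊕_ : ℕ[t] → ℕ[t] → ℕ[t]
[]      ⊕ q       = q
(a ∷ p) ⊕ []      = a ∷ p
(a ∷ p) ⊕ (b ∷ q) = (a + b) ∷ (p ⊕ q)

infixr 7 _·_
_·_ : ℕ → ℕ[t] → ℕ[t]
c · p = map (c *_) p

infix 8 t^_
t^_ : ℕ → ℕ[t]
t^ k = replicate k 0 ++ [ 1 ]

sumOver : {S : Setoid 0ℓ 0ℓ} → Finite S → (Setoid.Carrier S → ℕ[t]) → ℕ[t]
sumOver F f = foldr (λ x p → f x ⊕ p) [] (elements F)

A : ℕ → ℕ[t]
A n = sumOver (𝔖-finite n) λ π → t^ (des π + 1)

A⁽ᵃ⁾ : ℕ → ℕ[t]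
A⁽ᵃ⁾ n = sumOver (𝔅-finite n) λ π → t^ (ades π)

{-# OPTIONS --safe #-}
-- Fix the set of negative values of a signed permutation, and order the values
-- 0, π(1), …, π(n) by putting the nonnegative ones below the negative ones,
-- each part in its usual order.  This order is a rotation of the usual one, and
-- a step of a word is a descent for both orders unless it changes sign; the
-- changes of sign cancel around the cyclic word 0 π(1) … π(n) 0.  So ades(π) is
-- the number of cyclic descents for the new order, whose least element is 0:
-- this is des(σ) + 1 for the permutation σ that lists the ranks of π(1), …, π(n).
-- The pair of the negative set and σ determines π and is arbitrary.
module Submission where

open import Defs
open import Data.Nat using (ℕ; NonZero; _+_; _*_; _^_; _∸_; _≤_; _≟_)
open import Data.Product using (_×_)
open import Relation.Binary.PropositionalEquality using (_≡_)

open import Algebra.Properties.CommutativeSemigroup using (x∙yz≈y∙xz)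
open import Data.Bool.Base using (Bool; true; false; not; _xor_; if_then_else_)
import Data.Bool.Properties as Bool
open import Data.Fin.Base using (Fin; zero; suc; toℕ; fromℕ; fromℕ<; inject₁; punchIn)
import Data.Fin.Base as Fin
open import Data.Fin.Permutation as Perm
  using (Permutation′; _⟨$⟩ʳ_; _⟨$⟩ˡ_; insert; insert-punchIn; flip; _∘ₚ_; inverseˡ; inverseʳ)
import Data.Fin.Properties as Fin
open import Data.Integer.Base using (ℤ; -[1+_]; 0ℤ)
import Data.Integer.Base as ℤ
import Data.Integer.Properties as ℤ
open import Data.List.Base
  using (List; []; _∷_; [_]; _++_; length; filter; map; lookup; allFin; foldr; tabulate;
         cartesianProduct; cartesianProductWith)
open import Data.List.Membership.Propositional using (_∈_)
import Data.List.Membership.Propositional.Properties as Membership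
import Data.List.Membership.Setoid.Properties as SetoidMembership
import Data.List.Properties as List
open import Data.List.Relation.Unary.AllPairs using ([]; _∷_)
open import Data.List.Relation.Unary.All as All using ([]; _∷_)
open import Data.List.Relation.Unary.Any using (here; there; index)
open import Data.List.Relation.Unary.Unique.Setoid using (Unique)
import Data.List.Relation.Unary.Unique.Propositional.Properties as Unique
import Data.List.Relation.Unary.Unique.Setoid.Properties as SetoidUnique
open import Data.Maybe.Base using (Maybe; just; nothing)
open import Data.Nat.Base using (zero; suc)
import Data.Nat.Properties as ℕ
open import Data.Product using (Σ-syntax; _,_; proj₁; proj₂)
open import Data.Product.Properties using (,-injectiveˡ; ,-injectiveʳ)
open import Data.Product.Relation.Binary.Pointwise.NonDependent using (_×ₛ_)
open import Data.Maybe.Properties using (just-injective)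
open import Data.Vec.Base as Vec using (Vec; []; _∷_)
import Data.Vec.Properties as Vec
open import Function.Base using (_∘_; _$_)
open import Function.Bundles using (_↔_; Inverse; mk↔ₛ′; mk⇔)
open import Function.Construct.Composition using (_↔-∘_)
open import Function.Construct.Symmetry using (↔-sym)
open import Level using (0ℓ)
open import Relation.Binary.Bundles using (Setoid)
open import Relation.Binary.PropositionalEquality
  using (refl; sym; trans; cong; cong₂; subst; setoid; _≗_; module ≡-Reasoning)
open import Relation.Nullary using (does; contradiction)
open import Relation.Nullary.Decidable using (does-⇔; dec-true; dec-false)
open import Relation.Unary using (Pred; Decidable)

-- Counting

⟦_⟧ : Bool → ℕ
⟦ b ⟧ = if b then 1 else 0

module _ {X : Set} {P : Pred X 0ℓ} (P? : Decidable P) where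

  length-filter-∷ : ∀ x xs →
    length (filter P? (x ∷ xs)) ≡ ⟦ does (P? x) ⟧ + length (filter P? xs)
  length-filter-∷ x xs with does (P? x)
  ... | true  = refl
  ... | false = refl

  length-filter-map : ∀ {Y : Set} (f : Y → X) ys →
    length (filter P? (map f ys)) ≡ length (filter (P? ∘ f) ys)
  length-filter-map f []       = refl
  length-filter-map f (y ∷ ys) with does (P? (f y))
  ... | true  = cong suc (length-filter-map f ys)
  ... | false = length-filter-map f ys

  length-filter-++ : ∀ xs ys →
    length (filter P? (xs ++ ys)) ≡ length (filter P? xs) + length (filter P? ys)
  length-filter-++ xs ys =
    trans (cong length (List.filter-++ P? xs ys)) (List.length-++ (filter P? xs))

-- Source of the factor `2 ^ n`: the statistic on pairs ignores the signs, so every sign vector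
-- contributes one full copy of the count over permutations.
length-filter-proj₂ : ∀ {X Y : Set} {P : Pred X 0ℓ} (P? : Decidable P) (ys : List Y) xs →
  length (filter (P? ∘ proj₂) (cartesianProduct ys xs)) ≡ length ys * length (filter P? xs)
length-filter-proj₂ P? []       xs = refl
length-filter-proj₂ P? (y ∷ ys) xs =
  trans (length-filter-++ (P? ∘ proj₂) (map (y ,_) xs) (cartesianProduct ys xs))
        (cong₂ _+_ (length-filter-map (P? ∘ proj₂) (y ,_) xs) (length-filter-proj₂ P? ys xs))

count : ∀ {n} {P : Pred (Fin n) 0ℓ} → Decidable P → ℕ
count P? = length (filter P? (allFin _))

count-suc : ∀ {n} {P : Pred (Fin (suc n)) 0ℓ} (P? : Decidable P) →
            count P? ≡ ⟦ does (P? zero) ⟧ + count (P? ∘ suc)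
count-suc {n} P? = begin
  count P?
    ≡⟨ length-filter-∷ P? zero (tabulate suc) ⟩
  ⟦ does (P? zero) ⟧ + length (filter P? (tabulate suc))
    -- The tail of `allFin (suc n)` unfolds to `tabulate suc`; as a `map` of `suc` it lets the shift
    -- move from the list into the predicate.
    ≡⟨ cong (λ l → ⟦ does (P? zero) ⟧ + length (filter P? l)) (List.map-tabulate (λ i → i) suc) ⟨
  ⟦ does (P? zero) ⟧ + length (filter P? (map suc (allFin n)))
    ≡⟨ cong (⟦ does (P? zero) ⟧ +_) (length-filter-map P? suc (allFin n)) ⟩
  ⟦ does (P? zero) ⟧ + count (P? ∘ suc)
    ∎
  where open ≡-Reasoning

count-cong : ∀ {n} {P Q : Pred (Fin n) 0ℓ} (P? : Decidable P) (Q? : Decidable Q) →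
             does ∘ P? ≗ does ∘ Q? → count P? ≡ count Q?
count-cong {zero}  P? Q? e = refl
count-cong {suc n} P? Q? e = begin
  count P?                               ≡⟨ count-suc P? ⟩
  ⟦ does (P? zero) ⟧ + count (P? ∘ suc)  ≡⟨ cong₂ _+_ (cong ⟦_⟧ (e zero)) (count-cong _ _ (e ∘ suc)) ⟩
  ⟦ does (Q? zero) ⟧ + count (Q? ∘ suc)  ≡⟨ count-suc Q? ⟨
  count Q?                               ∎
  where open ≡-Reasoning

-- The telescoping sum of h (suc i) - h (inject₁ i), with the negative terms moved.
count-telescope : ∀ {n} {P Q : Pred (Fin n) 0ℓ} (P? : Decidable P) (Q? : Decidable Q)
  (h : Fin (suc n) → ℕ) →
  (∀ i → ⟦ does (P? i) ⟧ + h (inject₁ i) ≡ ⟦ does (Q? i) ⟧ + h (suc i)) →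
  count P? + h zero ≡ count Q? + h (fromℕ n)
count-telescope {zero}  P? Q? h e = refl
count-telescope {suc n} P? Q? h e = begin
  count P? + h zero
    ≡⟨ cong (_+ h zero) (trans (count-suc P?) (ℕ.+-comm p (count (P? ∘ suc)))) ⟩
  count (P? ∘ suc) + p + h zero
    ≡⟨ ℕ.+-assoc (count (P? ∘ suc)) p (h zero) ⟩
  count (P? ∘ suc) + (p + h zero)
    ≡⟨ cong (count (P? ∘ suc) +_) (e zero) ⟩
  count (P? ∘ suc) + (q + h (suc zero))
    ≡⟨ x∙yz≈y∙xz ℕ.+-commutativeSemigroup (count (P? ∘ suc)) q (h (suc zero)) ⟩
  q + (count (P? ∘ suc) + h (suc zero))
    ≡⟨ cong (q +_) (count-telescope (P? ∘ suc) (Q? ∘ suc) (h ∘ suc) (e ∘ suc)) ⟩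
  q + (count (Q? ∘ suc) + h (fromℕ (suc n)))
    ≡⟨ ℕ.+-assoc q (count (Q? ∘ suc)) (h (fromℕ (suc n))) ⟨
  q + count (Q? ∘ suc) + h (fromℕ (suc n))
    ≡⟨ cong (_+ h (fromℕ (suc n))) (count-suc Q?) ⟨
  count Q? + h (fromℕ (suc n))
    ∎
  where
  open ≡-Reasoning
  p = ⟦ does (P? zero) ⟧
  q = ⟦ does (Q? zero) ⟧

-- Comparing counts in two finite setoids

lookup-injective : ∀ (S : Setoid 0ℓ 0ℓ) {xs} → Unique S xs →
                   ∀ {i j} → Setoid._≈_ S (lookup xs i) (lookup xs j) → i ≡ j
lookup-injective S (x∉ ∷ xs!) {zero}  {zero}  e = refl
lookup-injective S (x∉ ∷ xs!) {zero}  {suc j} e =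
  contradiction e (All.lookup x∉ (Membership.∈-lookup j))
lookup-injective S (x∉ ∷ xs!) {suc i} {zero}  e =
  contradiction (Setoid.sym S e) (All.lookup x∉ (Membership.∈-lookup i))
lookup-injective S (x∉ ∷ xs!) {suc i} {suc j} e = cong suc (lookup-injective S xs! e)

module _ {S T : Setoid 0ℓ 0ℓ} (F : Finite S) (G : Finite T)
         {s : Setoid.Carrier S → ℕ} {t : Setoid.Carrier T → ℕ} where

  open Setoid S using () renaming (Carrier to X; _≈_ to _≈₁_)
  open Setoid T using () renaming (Carrier to Y; _≈_ to _≈₂_)

  -- The position of `f x` in the filtered enumeration of `T` defines a map between the index sets
  -- of the two filtered lists. It is injective because `f` is and the enumeration of `S` has no
  -- duplicates, so the lengths compare.
  number-mono-≤ : (∀ {x y} → x ≈₂ y → t x ≡ t y) →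
                  (f : X → Y) → (∀ {x y} → f x ≈₂ f y → x ≈₁ y) → (∀ x → t (f x) ≡ s x) →
                  ∀ k → number F (λ x → s x ≟ k) ≤ number G (λ y → t y ≟ k)
  number-mono-≤ t-cong f f-injective t∘f≡s k = Fin.injective⇒≤ {f = index ∘ image} λ {i} {j} e →
    lookup-injective S (SetoidUnique.filter⁺ S (λ x → s x ≟ k) (unique F))
      (f-injective (SetoidMembership.index-injective T (image i) (image j) e))
    where
    image = λ i → SetoidMembership.∈-filter⁺ T (λ y → t y ≟ k) (λ e p → trans (sym (t-cong e)) p)
      (complete G (f (lookup (filter (λ x → s x ≟ k) (elements F)) i)))
      (trans (t∘f≡s _) (proj₂ (Membership.∈-filter⁻ (λ x → s x ≟ k) {xs = elements F} (Membership.∈-lookup i))))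

-- Products and sign vectors

×-finite : ∀ {S T} → Finite S → Finite T → Finite (S ×ₛ T)
×-finite {S} {T} F G = record
  { elements = cartesianProduct (elements F) (elements G)
  ; complete = λ (x , y) → SetoidMembership.∈-cartesianProduct⁺ S T (complete F x) (complete G y)
  ; unique   = SetoidUnique.cartesianProduct⁺ S T (unique F) (unique G)
  }

Signs : ℕ → Setoid 0ℓ 0ℓ
Signs n = setoid (Vec Bool n)

Signs-finite : ∀ n → Finite (Signs n)
Signs-finite zero = record
  { elements = [ [] ]
  ; complete = λ { [] → here refl }
  ; unique   = [] ∷ []
  }
Signs-finite (suc n) = record
  { elements = cartesianProductWith _∷_ (true ∷ false ∷ []) (elements (Signs-finite n))
  ; complete = λ { (b ∷ ε) → Membership.∈-cartesianProductWith⁺ _∷_ (bool b) (complete (Signs-finite n) ε) }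
  ; unique   = Unique.cartesianProductWith⁺ _∷_ Vec.∷-injective
                 (((λ ()) ∷ []) ∷ [] ∷ []) (unique (Signs-finite n))
  }
  where
  bool : ∀ b → b ∈ (true ∷ false ∷ [])
  bool true  = here refl
  bool false = there (here refl)

length-Signs : ∀ n → length (elements (Signs-finite n)) ≡ 2 ^ n
length-Signs zero    = refl
length-Signs (suc n) = begin
  length (map (true ∷_) εs ++ map (false ∷_) εs ++ [])
    ≡⟨ List.length-++ (map (true ∷_) εs) ⟩
  length (map (true ∷_) εs) + length (map (false ∷_) εs ++ [])
    ≡⟨ cong₂ _+_ (List.length-map (true ∷_) εs) (List.length-++ (map (false ∷_) εs)) ⟩
  length εs + (length (map (false ∷_) εs) + 0)
    ≡⟨ cong (λ l → length εs + (l + 0)) (List.length-map (false ∷_) εs) ⟩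
  2 * length εs
    ≡⟨ cong (2 *_) (length-Signs n) ⟩
  2 ^ suc n
    ∎
  where
  open ≡-Reasoning
  εs = elements (Signs-finite n)

-- Generating functions

coeff-⊕ : ∀ p q k → coeff (p ⊕ q) k ≡ coeff p k + coeff q k
coeff-⊕ []      q       k       = refl
coeff-⊕ (a ∷ p) []      k       = sym (ℕ.+-identityʳ _)
coeff-⊕ (a ∷ p) (b ∷ q) zero    = refl
coeff-⊕ (a ∷ p) (b ∷ q) (suc k) = coeff-⊕ p q k

coeff-· : ∀ c p k → coeff (c · p) k ≡ c * coeff p k
coeff-· c []      k       = sym (ℕ.*-zeroʳ c)
coeff-· c (a ∷ p) zero    = refl
coeff-· c (a ∷ p) (suc k) = coeff-· c p k

coeff-t^ : ∀ m k → coeff (t^ m) k ≡ ⟦ does (m ≟ k) ⟧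
coeff-t^ zero    zero    = refl
coeff-t^ zero    (suc k) = refl
coeff-t^ (suc m) zero    = refl
coeff-t^ (suc m) (suc k) = coeff-t^ m k

coeff-sumOver : ∀ {S} (F : Finite S) (s : Setoid.Carrier S → ℕ) k →
                coeff (sumOver F (λ x → t^ (s x))) k ≡ number F (λ x → s x ≟ k)
coeff-sumOver F s k = go (elements F)
  where
  open ≡-Reasoning
  go : ∀ xs → coeff (foldr (λ x p → t^ (s x) ⊕ p) [] xs) k ≡ length (filter (λ x → s x ≟ k) xs)
  go []       = refl
  go (x ∷ xs) = begin
    coeff (t^ (s x) ⊕ foldr (λ x p → t^ (s x) ⊕ p) [] xs) k
      ≡⟨ coeff-⊕ (t^ (s x)) _ k ⟩
    coeff (t^ (s x)) k + coeff (foldr (λ x p → t^ (s x) ⊕ p) [] xs) k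
      ≡⟨ cong₂ _+_ (coeff-t^ (s x) k) (go xs) ⟩
    ⟦ does (s x ≟ k) ⟧ + length (filter (λ x → s x ≟ k) xs)
      ≡⟨ length-filter-∷ (λ x → s x ≟ k) x xs ⟨
    length (filter (λ x → s x ≟ k) (x ∷ xs))
      ∎

-- Signed permutations as pairs of signs and permutations

-- just (b , i) is the letter of absolute value i + 1, negative when b is true.
Letter : ℕ → Set
Letter n = Maybe (Bool × Fin n)

±↔Letter : ∀ n → ± n ↔ Letter n
±↔Letter n = mk↔ₛ′ to from to-from from-to
  where
  to : ± n → Letter n
  to (ℤ.+ zero   , _) = nothing
  to (ℤ.+ suc k  , p) = just (false , fromℕ< p)
  to (-[1+ k ] , p) = just (true , fromℕ< p)

  from : Letter n → ± n
  from nothing            = pos zero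
  from (just (false , i)) = pos (suc i)
  from (just (true  , i)) = neg (pos (suc i))

  to-from : ∀ x → to (from x) ≡ x
  to-from nothing            = refl
  to-from (just (false , i)) = cong (λ j → just (false , j)) (Fin.fromℕ<-toℕ i _)
  to-from (just (true  , i)) = cong (λ j → just (true , j)) (Fin.fromℕ<-toℕ i _)

  from-to : ∀ x → from (to x) ≡ x
  from-to (ℤ.+ zero   , p) = ±-≡ refl
  from-to (ℤ.+ suc k  , p) = ±-≡ (cong (ℤ.+_ ∘ suc) (Fin.toℕ-fromℕ< p))
  from-to (-[1+ k ] , p) = ±-≡ (cong -[1+_] (Fin.toℕ-fromℕ< p))

letter : ∀ {n} → Letter n → ± n
letter = Inverse.from (±↔Letter _)

letter-injective : ∀ {n} {x y : Letter n} → letter x ≡ letter y → x ≡ y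
letter-injective {n} e = trans (sym (Inverse.strictlyInverseˡ (±↔Letter n) _))
  (trans (cong (Inverse.to (±↔Letter n)) e) (Inverse.strictlyInverseˡ (±↔Letter n) _))

neg-involutive : ∀ {n} (x : ± n) → neg (neg x) ≡ x
neg-involutive (z , _) = ±-≡ (ℤ.neg-involutive z)

neg-letter : ∀ {n} b (i : Fin n) → neg (letter (just (b , i))) ≡ letter (just (not b , i))
neg-letter false i = refl
neg-letter true  i = neg-involutive _

xor-cancelʳ : ∀ b c → (b xor c) xor c ≡ b
xor-cancelʳ b c = begin
  (b xor c) xor c  ≡⟨ Bool.xor-assoc b c c ⟩
  b xor (c xor c)  ≡⟨ cong (b xor_) (Bool.xor-same c) ⟩
  b xor false      ≡⟨ Bool.xor-identityʳ b ⟩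
  b                ∎
  where open ≡-Reasoning

-- The sign of a letter of π is recorded at its absolute value, not at its position.
letters : ∀ {n} → Vec Bool n → Permutation′ n → Letter n ↔ Letter n
letters {n} ε ρ = mk↔ₛ′ to from to-from from-to
  where
  to : Letter n → Letter n
  to nothing        = nothing
  to (just (b , i)) = just (b xor Vec.lookup ε (ρ ⟨$⟩ʳ i) , ρ ⟨$⟩ʳ i)

  from : Letter n → Letter n
  from nothing        = nothing
  -- The sign stored at `j` is the one that `to` applied when it reached `j`; a second `xor` with it
  -- cancels.
  from (just (b , j)) = just (b xor Vec.lookup ε j , ρ ⟨$⟩ˡ j)

  to-from : ∀ x → to (from x) ≡ x
  to-from nothing        = refl
  to-from (just (b , j)) rewrite inverseʳ ρ {j} = cong (λ c → just (c , j)) (xor-cancelʳ b _)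

  from-to : ∀ x → from (to x) ≡ x
  from-to nothing        = refl
  from-to (just (b , i)) = cong just (cong₂ _,_ (xor-cancelʳ b _) (inverseˡ ρ))

signed : ∀ {n} → Vec Bool n → Permutation′ n → SignedPermutation n
signed {n} ε ρ = π , isSigned
  where
  π = ↔-sym (±↔Letter n) ↔-∘ (letters ε ρ ↔-∘ ±↔Letter n)

  isSigned : IsSigned π
  isSigned zero    = ±-≡ refl
  isSigned (suc i) = sym (neg-letter (Vec.lookup ε (ρ ⟨$⟩ʳ fromℕ< _)) _)

signed-letter : ∀ {n} (ε : Vec Bool n) ρ x →
  Inverse.to (proj₁ (signed ε ρ)) (letter x) ≡ letter (Inverse.to (letters ε ρ) x)
signed-letter {n} ε ρ x = cong (letter ∘ Inverse.to (letters ε ρ)) (Inverse.strictlyInverseˡ (±↔Letter n) x)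

lookup-ext : ∀ {X : Set} {n} {xs ys : Vec X n} → Vec.lookup xs ≗ Vec.lookup ys → xs ≡ ys
lookup-ext {xs = xs} {ys} e =
  trans (sym (Vec.tabulate∘lookup xs)) (trans (Vec.tabulate-cong e) (Vec.tabulate∘lookup ys))

signed-cong : ∀ {n} {ε ε′ : Vec Bool n} {ρ ρ′ : Permutation′ n} → ε ≡ ε′ → ρ Perm.≈ ρ′ →
              Setoid._≈_ (𝔅 n) (signed ε ρ) (signed ε′ ρ′)
signed-cong {n} {ε} {_} {ρ} {ρ′} refl e x = cong letter (go (Inverse.to (±↔Letter n) x))
  where
  go : Inverse.to (letters ε ρ) ≗ Inverse.to (letters ε ρ′)
  go nothing        = refl
  go (just (b , i)) = cong (λ j → just (b xor Vec.lookup ε j , j)) (e i)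

-- Evaluation at the positive letters shows both the absolute values and the signs attached to them.
signed-injective : ∀ {n} {ε ε′ : Vec Bool n} {ρ ρ′ : Permutation′ n} →
  Setoid._≈_ (𝔅 n) (signed ε ρ) (signed ε′ ρ′) → ε ≡ ε′ × ρ Perm.≈ ρ′
signed-injective {n} {ε} {ε′} {ρ} {ρ′} e = lookup-ext ε≗ε′ , ,-injectiveʳ ∘ letter≡
  where
  open ≡-Reasoning

  letter≡ : ∀ i → (Vec.lookup ε (ρ ⟨$⟩ʳ i) , ρ ⟨$⟩ʳ i) ≡ (Vec.lookup ε′ (ρ′ ⟨$⟩ʳ i) , ρ′ ⟨$⟩ʳ i)
  letter≡ i = just-injective $ letter-injective $
    trans (sym (signed-letter ε ρ (just (false , i))))
          (trans (e (letter (just (false , i)))) (signed-letter ε′ ρ′ (just (false , i))))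

  ε≗ε′ : Vec.lookup ε ≗ Vec.lookup ε′
  ε≗ε′ j = begin
    -- Signs are indexed by absolute value, so `j` is first written as the image under `ρ` of the
    -- position where it occurs.
    Vec.lookup ε j                        ≡⟨ cong (Vec.lookup ε) (inverseʳ ρ) ⟨
    Vec.lookup ε (ρ ⟨$⟩ʳ (ρ ⟨$⟩ˡ j))      ≡⟨ ,-injectiveˡ (letter≡ (ρ ⟨$⟩ˡ j)) ⟩
    Vec.lookup ε′ (ρ′ ⟨$⟩ʳ (ρ ⟨$⟩ˡ j))    ≡⟨ cong (Vec.lookup ε′) (,-injectiveʳ (letter≡ (ρ ⟨$⟩ˡ j))) ⟨
    Vec.lookup ε′ (ρ ⟨$⟩ʳ (ρ ⟨$⟩ˡ j))     ≡⟨ cong (Vec.lookup ε′) (inverseʳ ρ) ⟩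
    Vec.lookup ε′ j                       ∎

-- Recovering the signs and the permutation of absolute values

module _ {n} (π : ± n ↔ ± n) (o : IsSigned π) where

  open ≡-Reasoning
  open Inverse π using (to; from; strictlyInverseˡ; strictlyInverseʳ)

  -- `IsSigned` tests nonnegative arguments only; a negative argument reduces to these because `neg`
  -- is an involution.
  to-neg : ∀ x → to (neg x) ≡ neg (to x)
  to-neg x = subst (λ x → to (neg x) ≡ neg (to x))
    (Inverse.strictlyInverseʳ (±↔Letter n) x) (go (Inverse.to (±↔Letter n) x))
    where
    go : ∀ x → to (neg (letter x)) ≡ neg (to (letter x))
    go nothing            = o zero
    go (just (false , i)) = o (suc i)
    go (just (true  , i)) = begin
      to (neg (neg (pos (suc i))))  ≡⟨ cong to (neg-involutive _) ⟩
      to (pos (suc i))              ≡⟨ neg-involutive _ ⟨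
      neg (neg (to (pos (suc i))))  ≡⟨ cong neg (o (suc i)) ⟨
      neg (to (neg (pos (suc i))))  ∎

  from-neg : ∀ x → from (neg x) ≡ neg (from x)
  from-neg x = begin
    from (neg x)              ≡⟨ cong (from ∘ neg) (strictlyInverseˡ x) ⟨
    from (neg (to (from x)))  ≡⟨ cong from (to-neg (from x)) ⟨
    from (to (neg (from x)))  ≡⟨ strictlyInverseʳ _ ⟩
    neg (from x)              ∎

-- Serves two purposes: it supplies the inverse of `absolute π`, and the sign that `π` gives to the
-- absolute value `j` is the sign of the inverse at the positive letter `j`.
inverse : ∀ {n} → SignedPermutation n → SignedPermutation n
inverse (π , o) = ↔-sym π , λ s → from-neg π o (pos s)

module _ {n} (π : SignedPermutation n) where

  open Inverse (proj₁ π) using (to; from; strictlyInverseˡ; strictlyInverseʳ)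
  open ≡-Reasoning

  -- Oddness makes the image of 0 a fixed point of `neg`, and 0 is the only one.
  to-zero : to (pos zero) ≡ pos zero
  to-zero = neg-fixed (to (pos zero)) (trans (sym (proj₂ π zero)) (cong to (±-≡ refl)))
    where
    neg-fixed : ∀ (x : ± n) → neg x ≡ x → x ≡ pos zero
    neg-fixed (ℤ.+ zero   , _) _ = ±-≡ refl
    neg-fixed (ℤ.+ suc _  , _) e with () ← cong proj₁ e
    neg-fixed (-[1+ _ ] , _) e with () ← cong proj₁ e

  -- The value at a nonzero letter is nonzero, since 0 is already the value at 0 and `π` is
  -- injective.
  image : ∀ i → Σ[ x ∈ Bool × Fin n ] to (letter (just (false , i))) ≡ letter (just x)
  image i = go _ (sym (Inverse.strictlyInverseʳ (±↔Letter n) (to (pos (suc i)))))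
    where
    go : ∀ x → to (pos (suc i)) ≡ letter x → Σ[ x ∈ Bool × Fin n ] to (pos (suc i)) ≡ letter (just x)
    go (just x) e = x , e
    go nothing  e with () ← cong proj₁ (begin
      pos (suc i)              ≡⟨ strictlyInverseʳ _ ⟨
      from (to (pos (suc i)))  ≡⟨ cong from (trans e (sym to-zero)) ⟩
      from (to (pos zero))     ≡⟨ strictlyInverseʳ _ ⟩
      pos zero                 ∎)

  to-letter : ∀ {b c i j} → to (letter (just (false , i))) ≡ letter (just (c , j)) →
              to (letter (just (b , i))) ≡ letter (just (b xor c , j))
  to-letter {false}             e = e
  to-letter {true} {c} {i} {j} e = begin
    to (neg (pos (suc i)))       ≡⟨ proj₂ π (suc i) ⟩
    neg (to (pos (suc i)))       ≡⟨ cong neg e ⟩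
    neg (letter (just (c , j)))  ≡⟨ neg-letter c j ⟩
    letter (just (not c , j))    ∎

  from-letter : ∀ {c i j} → to (letter (just (false , i))) ≡ letter (just (c , j)) →
                from (letter (just (false , j))) ≡ letter (just (c , i))
  from-letter {c} {i} {j} e = begin
    -- The positive letter `j` is recast with sign `c xor c`, which exhibits it as the value at the
    -- letter `(c , i)`.
    from (letter (just (false , j)))     ≡⟨ cong (λ b → from (letter (just (b , j)))) (Bool.xor-same c) ⟨
    from (letter (just (c xor c , j)))   ≡⟨ cong from (to-letter {c} e) ⟨
    from (to (letter (just (c , i))))    ≡⟨ strictlyInverseʳ _ ⟩
    letter (just (c , i))                ∎

image-inverse : ∀ {n} (π : SignedPermutation n) i →
  proj₁ (image (inverse π) (proj₂ (proj₁ (image π i)))) ≡ (proj₁ (proj₁ (image π i)) , i)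
image-inverse π i = just-injective $ letter-injective $
  trans (sym (proj₂ (image (inverse π) _))) (from-letter π (proj₂ (image π i)))

image-inverse′ : ∀ {n} (π : SignedPermutation n) j →
  proj₁ (image π (proj₂ (proj₁ (image (inverse π) j)))) ≡ (proj₁ (proj₁ (image (inverse π) j)) , j)
image-inverse′ π j = just-injective $ letter-injective $
  trans (sym (proj₂ (image π _))) (from-letter (inverse π) (proj₂ (image (inverse π) j)))

signs : ∀ {n} → SignedPermutation n → Vec Bool n
signs π = Vec.tabulate λ j → proj₁ (proj₁ (image (inverse π) j))

absolute : ∀ {n} → SignedPermutation n → Permutation′ n
absolute π = mk↔ₛ′
  (λ i → proj₂ (proj₁ (image π i)))
  (λ j → proj₂ (proj₁ (image (inverse π) j)))
  (λ j → cong proj₂ (image-inverse′ π j))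
  (λ i → cong proj₂ (image-inverse π i))

-- Both sides are odd and agree on positive letters: there `image-inverse` identifies the sign
-- stored at the absolute value with the sign at the position.
signed-signs-absolute : ∀ {n} (π : SignedPermutation n) →
                        Setoid._≈_ (𝔅 n) (signed (signs π) (absolute π)) π
signed-signs-absolute {n} π x =
  trans (go (Inverse.to (±↔Letter n) x)) (cong (Inverse.to (proj₁ π)) (Inverse.strictlyInverseʳ (±↔Letter n) x))
  where
  open ≡-Reasoning
  go : ∀ x → letter (Inverse.to (letters (signs π) (absolute π)) x) ≡ Inverse.to (proj₁ π) (letter x)
  go nothing        = sym (to-zero π)
  go (just (b , i)) = begin
    letter (just (b xor Vec.lookup (signs π) j , j))
      ≡⟨ cong (λ c → letter (just (b xor c , j))) (trans (Vec.lookup∘tabulate _ j) (cong proj₁ (image-inverse π i))) ⟩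
    letter (just (b xor proj₁ (proj₁ (image π i)) , j))
      ≡⟨ to-letter π (proj₂ (image π i)) ⟨
    Inverse.to (proj₁ π) (letter (just (b , i)))
      ∎
    where j = proj₂ (proj₁ (image π i))

-- The rotated order of the values

-- The letter 1 is the least of the nonzero values, and the letter -1 the greatest.
rank : ∀ {n} → Vec Bool n → Permutation′ n
rank []                 = Perm.id
rank (false ∷ ε)        = insert zero zero (rank ε)
rank {suc n} (true ∷ ε) = insert zero (fromℕ n) (rank ε)

-- The strict rotated order on nonzero letters. Inside each sign class it is the usual order of
-- integers, hence reversed in absolute value for negative letters.
precedes : ∀ {n} → Bool → Bool → Fin n → Fin n → Bool
precedes false false j k = does (j Fin.<? k)
precedes false true  j k = true
precedes true  false j k = false
precedes true  true  j k = does (k Fin.<? j)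

punchIn-<? : ∀ {n} (i : Fin (suc n)) j k → does (punchIn i j Fin.<? punchIn i k) ≡ does (j Fin.<? k)
punchIn-<? i j k = does-⇔ (mk⇔
  (λ p → ℕ.≰⇒> λ q → ℕ.<⇒≱ p (Fin.punchIn-mono-≤ i k j q))
  (λ p → ℕ.≰⇒> λ q → ℕ.<⇒≱ p (Fin.punchIn-cancel-≤ i k j q)))
  (punchIn i j Fin.<? punchIn i k) (j Fin.<? k)

toℕ-punchIn-fromℕ : ∀ {n} (j : Fin n) → toℕ (punchIn (fromℕ n) j) ≡ toℕ j
toℕ-punchIn-fromℕ zero    = refl
toℕ-punchIn-fromℕ (suc j) = cong suc (toℕ-punchIn-fromℕ j)

punchIn-fromℕ-< : ∀ {n} (j : Fin n) → punchIn (fromℕ n) j Fin.< fromℕ n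
punchIn-fromℕ-< {n} j rewrite toℕ-punchIn-fromℕ j | Fin.toℕ-fromℕ n = Fin.toℕ<n j

-- Induction on the signs. The letter of absolute value 1 is an extreme of the rotated order and
-- `insert` puts it at that end; the ranks of the other letters pass through `punchIn`, which
-- preserves and reflects order.
rank-<? : ∀ {n} (ε : Vec Bool n) j k →
  does (rank ε ⟨$⟩ʳ j Fin.<? rank ε ⟨$⟩ʳ k) ≡ precedes (Vec.lookup ε j) (Vec.lookup ε k) j k
rank-<? (false ∷ _) zero zero = refl
rank-<? {suc n} (true ∷ _) zero zero = dec-false (fromℕ n Fin.<? fromℕ n) (ℕ.<-irrefl refl)
rank-<? (false ∷ ε) zero (suc k) with Vec.lookup ε k
... | false = refl
... | true  = refl
rank-<? {suc n} (true ∷ ε) zero (suc k) with Vec.lookup ε k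
... | false rewrite insert-punchIn zero (fromℕ n) (rank ε) k =
  dec-false (_ Fin.<? _) (ℕ.<⇒≯ (punchIn-fromℕ-< (rank ε ⟨$⟩ʳ k)))
... | true rewrite insert-punchIn zero (fromℕ n) (rank ε) k =
  dec-false (_ Fin.<? _) (ℕ.<⇒≯ (punchIn-fromℕ-< (rank ε ⟨$⟩ʳ k)))
rank-<? (false ∷ ε) (suc j) zero with Vec.lookup ε j
... | false = refl
... | true  = refl
rank-<? {suc n} (true ∷ ε) (suc j) zero with Vec.lookup ε j
... | false rewrite insert-punchIn zero (fromℕ n) (rank ε) j =
  dec-true (_ Fin.<? _) (punchIn-fromℕ-< (rank ε ⟨$⟩ʳ j))
... | true rewrite insert-punchIn zero (fromℕ n) (rank ε) j =
  dec-true (_ Fin.<? _) (punchIn-fromℕ-< (rank ε ⟨$⟩ʳ j))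
rank-<? {suc n} (b ∷ ε) (suc j) (suc k) =
  trans (inserted b) (trans (rank-<? ε j k) (shift (Vec.lookup ε j) (Vec.lookup ε k)))
  where
  inserted : ∀ b → does (rank (b ∷ ε) ⟨$⟩ʳ suc j Fin.<? rank (b ∷ ε) ⟨$⟩ʳ suc k) ≡
                   does (rank ε ⟨$⟩ʳ j Fin.<? rank ε ⟨$⟩ʳ k)
  inserted false = refl
  inserted true
    rewrite insert-punchIn zero (fromℕ n) (rank ε) j | insert-punchIn zero (fromℕ n) (rank ε) k
    = punchIn-<? (fromℕ n) _ _

  shift : ∀ b c → precedes b c j k ≡ precedes b c (suc j) (suc k)
  shift false false = refl
  shift false true  = refl
  shift true  false = refl
  shift true  true  = refl

-- Augmented descents as descents in the rotated order

value : ∀ {n} → Letter n → ℤ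
value = proj₁ ∘ letter

-- The two orders agree on letters of equal sign and disagree on letters of opposite sign; the sign
-- indicators compensate exactly for the disagreement.
value-<? : ∀ {n} b c (j k : Fin n) →
  ⟦ does (value (just (b , j)) ℤ.<? value (just (c , k))) ⟧ + ⟦ c ⟧ ≡ ⟦ precedes b c j k ⟧ + ⟦ b ⟧
value-<? false false j k = refl
value-<? false true  j k = refl
value-<? true  false j k = refl
value-<? true  true  j k = refl

-- The word 0 σ(1) … σ(n), so that σ(i) is moved up by one.
word : ∀ {n} → Permutation′ n → Fin (suc n) → Fin (suc n)
word σ zero    = zero
word σ (suc i) = suc (σ ⟨$⟩ʳ i)

-- Passing from integer descents to rotated descents costs the net change of sign along the word,
-- which telescopes to the sign of the last letter.
ades-signed : ∀ {m} (ε : Vec Bool (suc m)) ρ → ades (signed ε ρ) ≡ des (ρ ∘ₚ rank ε) + 1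
ades-signed {m} ε ρ = begin
  ades π
    ≡⟨ cong₂ (λ d z → d + ⟦ does (0ℤ ℤ.<? z) ⟧)
         (count-cong _ P? λ i → cong₂ (λ y z → does (y ℤ.<? z)) (⟨⟩≡value (suc i)) (⟨⟩≡value (inject₁ i)))
         (⟨⟩≡value (fromℕ (suc m))) ⟩
  count P? + last
    -- The added 0 is the sign indicator of the initial letter 0, where the telescope starts.
    ≡⟨ cong (_+ last) (trans (sym (ℕ.+-identityʳ _)) (count-telescope P? Q? (negative ∘ x) step)) ⟩
  count Q? + negative (x (fromℕ (suc m))) + last
    ≡⟨ ℕ.+-assoc (count Q?) _ last ⟩
  count Q? + (negative (x (fromℕ (suc m))) + last)
    ≡⟨ cong₂ _+_
         -- The step from 0 to the first letter is never a descent in the rotated order, so it drops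
         -- out.
         (trans (count-suc Q?) (count-cong _ (λ i → σ ⟨$⟩ʳ suc i Fin.<? σ ⟨$⟩ʳ inject₁ i) λ _ → refl))
         -- The last letter is either negative, and the telescope leaves 1, or positive, and
         -- position `n` is an augmented descent.
         (nonzero (Vec.lookup ε (ρ ⟨$⟩ʳ fromℕ m)) (ρ ⟨$⟩ʳ fromℕ m)) ⟩
  des σ + 1
    ∎
  where
  open ≡-Reasoning
  π = signed ε ρ
  σ = ρ ∘ₚ rank ε

  x : Fin (suc (suc m)) → Letter (suc m)
  x zero    = nothing
  x (suc i) = just (Vec.lookup ε (ρ ⟨$⟩ʳ i) , ρ ⟨$⟩ʳ i)

  ⟨⟩≡value : ∀ s → π ⟨ s ⟩ ≡ value (x s)
  ⟨⟩≡value zero    = refl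
  ⟨⟩≡value (suc i) = cong proj₁ (signed-letter ε ρ (just (false , i)))

  last = ⟦ does (0ℤ ℤ.<? value (x (fromℕ (suc m)))) ⟧

  negative : Letter (suc m) → ℕ
  negative nothing        = 0
  negative (just (b , _)) = ⟦ b ⟧

  P? = λ i → value (x (suc i)) ℤ.<? value (x (inject₁ i))
  Q? = λ i → word σ (suc i) Fin.<? word σ (inject₁ i)

  step : ∀ i → ⟦ does (P? i) ⟧ + negative (x (inject₁ i)) ≡ ⟦ does (Q? i) ⟧ + negative (x (suc i))
  -- Against the letter 0, an integer descent occurs exactly when the first letter is negative.
  step zero with Vec.lookup ε (ρ ⟨$⟩ʳ zero)
  ... | false = refl
  ... | true  = refl
  step (suc i) = trans (value-<? (Vec.lookup ε j) (Vec.lookup ε k) j k)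
    (cong (λ b → ⟦ b ⟧ + ⟦ Vec.lookup ε j ⟧) (sym (rank-<? ε j k)))
    where
    j = ρ ⟨$⟩ʳ suc i
    k = ρ ⟨$⟩ʳ inject₁ i

  nonzero : ∀ b (j : Fin (suc m)) → ⟦ b ⟧ + ⟦ does (0ℤ ℤ.<? value (just (b , j))) ⟧ ≡ 1
  nonzero false j = refl
  nonzero true  j = refl

-- The equality of counts

des-cong : ∀ {n} {σ σ′ : Permutation′ n} → σ Perm.≈ σ′ → des σ ≡ des σ′
des-cong {zero}  e = refl
des-cong {suc m} e = count-cong _ _ λ i → cong₂ (λ j k → does (j Fin.<? k)) (e (suc i)) (e (inject₁ i))

ades-cong : ∀ {n} {π π′ : SignedPermutation n} → Setoid._≈_ (𝔅 n) π π′ → ades π ≡ ades π′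
ades-cong {n} {π} {π′} e = cong₂ (λ d z → d + ⟦ does (0ℤ ℤ.<? z) ⟧)
  (count-cong _ _ λ i → cong₂ (λ y z → does (y ℤ.<? z)) (e⟨⟩ (suc i)) (e⟨⟩ (inject₁ i))) (e⟨⟩ (fromℕ n))
  where
  e⟨⟩ : ∀ s → π ⟨ s ⟩ ≡ π′ ⟨ s ⟩
  e⟨⟩ s = cong proj₁ (e (pos s))

-- `split` and `join` are injections, up to pointwise equality, that carry `ades` to `des + 1` and
-- back, so the counts bound each other; counting pairs then gives a product.
number-ades : ∀ m k → number (𝔅-finite (suc m)) (λ π → ades π ≟ k) ≡
                      2 ^ suc m * number (𝔖-finite (suc m)) (λ σ → des σ + 1 ≟ k)
number-ades m k = begin
  number (𝔅-finite n) (λ π → ades π ≟ k)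
    ≡⟨ ℕ.≤-antisym
         (number-mono-≤ (𝔅-finite n) 𝔓-finite {ades} {stat} (λ {p} {p′} → stat-cong {p} {p′})
           split (λ {π} {π′} → split-injective {π} {π′}) stat∘split k)
         (number-mono-≤ 𝔓-finite (𝔅-finite n) {stat} {ades} (λ {π} {π′} → ades-cong {π = π} {π′})
           join (λ {p} {p′} → join-injective {p} {p′}) ades∘join k) ⟩
  number 𝔓-finite (λ p → stat p ≟ k)
    ≡⟨ length-filter-proj₂ (λ σ → des σ + 1 ≟ k) (elements (Signs-finite n)) (elements (𝔖-finite n)) ⟩
  length (elements (Signs-finite n)) * number (𝔖-finite n) (λ σ → des σ + 1 ≟ k)
    ≡⟨ cong (_* number (𝔖-finite n) (λ σ → des σ + 1 ≟ k)) (length-Signs n) ⟩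
  2 ^ n * number (𝔖-finite n) (λ σ → des σ + 1 ≟ k)
    ∎
  where
  open ≡-Reasoning
  n = suc m
  𝔓-finite = ×-finite (Signs-finite n) (𝔖-finite n)
  open Setoid (Signs n ×ₛ 𝔖 n) using () renaming (Carrier to Pair; _≈_ to _≈ₚ_)
  open Setoid (𝔅 n) using () renaming (_≈_ to _≈ᵇ_)

  stat : Pair → ℕ
  stat (_ , σ) = des σ + 1

  stat-cong : ∀ {p p′} → p ≈ₚ p′ → stat p ≡ stat p′
  stat-cong {_ , σ} {_ , σ′} (_ , e) = cong (_+ 1) (des-cong {σ = σ} {σ′} e)

  split : SignedPermutation n → Pair
  -- Composing with the rank for the given signs replaces each letter by its place in the rotated
  -- order.
  split π = signs π , absolute π ∘ₚ rank (signs π)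

  join : Pair → SignedPermutation n
  join (ε , σ) = signed ε (σ ∘ₚ flip (rank ε))

  join-cong : ∀ {p p′} → p ≈ₚ p′ → join p ≈ᵇ join p′
  join-cong {ε , σ} {_ , σ′} (refl , e) =
    signed-cong {ε = ε} {ρ = σ ∘ₚ flip (rank ε)} {σ′ ∘ₚ flip (rank ε)} refl (cong (rank ε ⟨$⟩ˡ_) ∘ e)

  join∘split : ∀ π → join (split π) ≈ᵇ π
  join∘split π x = trans
    (signed-cong {ε = ε} {ρ = (absolute π ∘ₚ rank ε) ∘ₚ flip (rank ε)} {absolute π}
      refl (λ _ → inverseˡ (rank ε)) x)
    (signed-signs-absolute π x)
    where ε = signs π

  split-injective : ∀ {π π′} → split π ≈ₚ split π′ → π ≈ᵇ π′
  split-injective {π} {π′} e x =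
    trans (sym (join∘split π x)) (trans (join-cong {split π} {split π′} e x) (join∘split π′ x))

  join-injective : ∀ {p p′} → join p ≈ᵇ join p′ → p ≈ₚ p′
  join-injective {ε , σ} {ε′ , σ′} e
    with signed-injective {ε = ε} {ε′} {σ ∘ₚ flip (rank ε)} {σ′ ∘ₚ flip (rank ε′)} e
  -- Once the signs are identified, the same `rank ε` occurs on both sides and can be cancelled.
  ... | refl , h = refl , λ i →
    trans (sym (inverseʳ (rank ε))) (trans (cong (rank ε ⟨$⟩ʳ_) (h i)) (inverseʳ (rank ε)))

  stat∘split : ∀ π → stat (split π) ≡ ades π
  stat∘split π = trans (sym (ades-signed (signs π) (absolute π)))
    (ades-cong {π = signed (signs π) (absolute π)} {π} (signed-signs-absolute π))

  ades∘join : ∀ p → ades (join p) ≡ stat p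
  ades∘join (ε , σ) = trans (ades-signed ε (σ ∘ₚ flip (rank ε)))
    (cong (_+ 1) (des-cong {σ = (σ ∘ₚ flip (rank ε)) ∘ₚ rank ε} {σ} λ _ → inverseʳ (rank ε)))

proposition1p2 : (n : ℕ) → .{{_ : NonZero n}} →
    ((i : ℕ) → i ≤ n ∸ 1 →
    number (𝔅-finite n) (λ π → ades π ≟ i + 1) ≡ 2 ^ n * number (𝔖-finite n) (λ π → des π ≟ i))
    × (A⁽ᵃ⁾ n ≋ 2 ^ n · A n)
proposition1p2 n@(suc m) = counts , generating
  where
  open ≡-Reasoning

  counts : ∀ i → i ≤ m →
    number (𝔅-finite n) (λ π → ades π ≟ i + 1) ≡ 2 ^ n * number (𝔖-finite n) (λ π → des π ≟ i)
  counts i _ = trans (number-ades m (i + 1)) (cong (λ l → 2 ^ n * length l)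
    (List.filter-≐ (λ σ → des σ + 1 ≟ i + 1) (λ σ → des σ ≟ i)
      -- Cancelling the common 1 turns the exponent `des σ + 1` of the generating function into the
      -- plain descent number.
      (ℕ.+-cancelʳ-≡ 1 _ i , cong (_+ 1)) (elements (𝔖-finite n))))

  generating : A⁽ᵃ⁾ n ≋ 2 ^ n · A n
  generating k = begin
    coeff (A⁽ᵃ⁾ n) k
      ≡⟨ coeff-sumOver (𝔅-finite n) ades k ⟩
    number (𝔅-finite n) (λ π → ades π ≟ k)
      ≡⟨ number-ades m k ⟩
    2 ^ n * number (𝔖-finite n) (λ π → des π + 1 ≟ k)
      ≡⟨ cong (2 ^ n *_) (coeff-sumOver (𝔖-finite n) (λ π → des π + 1) k) ⟨
    2 ^ n * coeff (A n) k
      ≡⟨ coeff-· (2 ^ n) (A n) k ⟨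
    coeff (2 ^ n · A n) k
      ∎
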